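{- Let $G$ be a finite simple graph that is not a complete graph, and let $\phi$ be a semi-transitive orientation of $G$. Then there exist two distinct non-adjacent vertices $u,v\in V(G)$ such that $\phi$ can be extended to a semi-transitive orientation of $G+uv$; that is, there is a semi-transitive orientation of $G+uv$ that agrees with $\phi$ on every edge of $G$.
   Context: Graphs are finite, undirected and simple. An orientation of a graph assigns to each edge one of its two directions; it is acyclic if it has no directed cycle. A digraph is transitive if whenever $v_1\to v_2$ and $v_2\to v_3$ are directed edges on three distinct vertices, $v_1\to v_3$ is also a directed edge. Given an acyclic orientation $\phi$ of a graph $G$, a shortcut in $\phi(G)$ is a non-transitive induced subdigraph of $\phi(G)$ on a vertex set $\{v_1,\dots,v_n\}$ with $n\ge 4$ (distinct vertices) that contains the directed path $v_1\to v_2\to\cdots\to v_n$ and the directed edge $v_1\to v_n$. An acyclic orientation $\phi$ is semi-transitive if $\phi(G)$ contains no shortcut. $G+uv$ denotes the graph obtained from $G$ by adding the edge $uv$. -}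

module Defs where

open import Data.Fin.Base using (Fin; zero; suc; inject₁; fromℕ)
open import Data.Fin.Properties using (_≟_)
open import Data.Nat.Base using (ℕ; suc; _≤_)
open import Data.Product.Base using (Σ; _×_; _,_)
open import Data.Sum.Base using (_⊎_; inj₁; inj₂)
open import Function.Bundles using (_⇔_)
open import Function.Definitions using (Injective)
open import Level using (0ℓ)
open import Relation.Binary.Core using (Rel)
open import Relation.Binary.Definitions using (Symmetric; Irreflexive; Asymmetric; Decidable)
open import Relation.Binary.PropositionalEquality using (_≡_; _≢_; refl; sym; trans)
open import Relation.Nullary using (¬_)
open import Relation.Nullary.Decidable using (_×-dec_; _⊎-dec_)
open import Function.Base using (_on_)

-- Decidability of adjacency is automatic for a finite graph classically;
-- constructively it is part of being given a finite graph.
record Graph (n : ℕ) : Set₁ where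
  field
    Adj        : Rel (Fin n) 0ℓ
    adj-sym    : Symmetric Adj
    adj-irrefl : Irreflexive _≡_ Adj
    adj?       : Decidable Adj

open Graph public

Complete : {n : ℕ} → Graph n → Set
Complete G = ∀ u v → u ≢ v → Adj G u v

addEdge : {n : ℕ} (G : Graph n) (u v : Fin n) → u ≢ v → Graph n
addEdge {n} G u v u≢v = record
  { Adj        = Adj⁺
  ; adj-sym    = λ { (inj₁ e)                   → inj₁ (adj-sym G e)
                   ; (inj₂ (inj₁ (x≡u , y≡v))) → inj₂ (inj₂ (y≡v , x≡u))
                   ; (inj₂ (inj₂ (x≡v , y≡u))) → inj₂ (inj₁ (y≡u , x≡v)) }
  ; adj-irrefl = λ { refl (inj₁ e)                   → adj-irrefl G refl e
                   ; refl (inj₂ (inj₁ (x≡u , x≡v))) → u≢v (trans (sym x≡u) x≡v)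
                   ; refl (inj₂ (inj₂ (x≡v , x≡u))) → u≢v (trans (sym x≡u) x≡v) }
  ; adj?       = λ x y → adj? G x y ⊎-dec ((x ≟ u ×-dec y ≟ v) ⊎-dec (x ≟ v ×-dec y ≟ u))
  }
  where
  Adj⁺ : Rel (Fin n) 0ℓ
  Adj⁺ x y = Adj G x y ⊎ ((x ≡ u × y ≡ v) ⊎ (x ≡ v × y ≡ u))

-- By covers and arc-asym, exactly one direction is chosen for each edge.
record Orientation {n : ℕ} (G : Graph n) : Set₁ where
  field
    Arc      : Rel (Fin n) 0ℓ
    arc⇒adj  : ∀ {x y} → Arc x y → Adj G x y
    covers   : ∀ {x y} → Adj G x y → Arc x y ⊎ Arc y x
    arc-asym : Asymmetric Arc

open Orientation public

-- Transitivity is demanded only on three distinct vertices.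
TransitiveDigraph : {V : Set} → Rel V 0ℓ → Set
TransitiveDigraph _⟶_ =
  ∀ x y z → x ≢ y → y ≢ z → x ≢ z → x ⟶ y → y ⟶ z → x ⟶ z

-- A directed path with m arcs, hence m + 1 distinct vertices.
record DirectedPath {V : Set} (_⟶_ : Rel V 0ℓ) (m : ℕ) : Set where
  field
    vertex   : Fin (suc m) → V
    distinct : Injective _≡_ _≡_ vertex
    step     : (i : Fin m) → vertex (inject₁ i) ⟶ vertex (suc i)

  source : V
  source = vertex zero

  target : V
  target = vertex (fromℕ m)

open DirectedPath public

DirectedCycle : {V : Set} → Rel V 0ℓ → Set
DirectedCycle _⟶_ =
  Σ ℕ λ m → Σ (DirectedPath _⟶_ m) λ p → target p ⟶ source p

-- The subdigraph induced on the vertices of p is the relation pulled back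
-- along the injection vertex p.
Shortcut : {V : Set} → Rel V 0ℓ → Set
Shortcut _⟶_ =
  Σ ℕ λ m → 4 ≤ suc m × Σ (DirectedPath _⟶_ m) λ p →
    source p ⟶ target p × ¬ TransitiveDigraph (_⟶_ on vertex p)

Acyclic : {n : ℕ} {G : Graph n} → Orientation G → Set
Acyclic φ = ¬ DirectedCycle (Arc φ)

SemiTransitive : {n : ℕ} {G : Graph n} → Orientation G → Set
SemiTransitive φ = Acyclic φ × ¬ Shortcut (Arc φ)

Extends : {n : ℕ} {G H : Graph n} → Orientation H → Orientation G → Set
Extends {G = G} ψ φ = ∀ x y → Adj G x y → Arc ψ x y ⇔ Arc φ x y

{-# OPTIONS --safe #-}

-- An acyclic orientation is semi-transitive iff x → y and x ⇝ a → b → c ⇝ y always force a → c. If some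
-- non-adjacent u, v satisfy u ⇝ v, choose them with an inclusion-minimal interval [u, v] and add u → v:
-- reachability does not change, so an old arc x → y still satisfies the criterion, and the new arc does by
-- minimality of [u, v]. Otherwise φ is a strict partial order, and adding a critical pair (u, v), that is
-- an incomparable pair with everything below u below v and everything above v above u, gives again a strict
-- partial order.
module Submission where

open import Defs
open import Data.Empty using (⊥-elim)
open import Data.Nat.Base using (ℕ; zero; suc; _≤_; z≤n; s≤s)
open import Data.Nat.Properties using (≤-refl; ≤-trans; m≤n⇒m≤1+n)
open import Data.Fin.Base using (Fin; zero; suc; inject₁; fromℕ)
open import Data.Fin.Properties using (_≟_; any?)
open import Data.Fin.Induction using (spo-wellFounded; spo-noetherian)
open import Data.Fin.Relation.Unary.Top using (view; ‵fromℕ; ‵inject₁)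
open import Data.Product.Base using (Σ; _×_; _,_; ∃; ∃₂; proj₁; proj₂)
open import Data.Sum.Base using (_⊎_; inj₁; inj₂; [_,_]′)
open import Function.Base using (_∘_; flip; _on_)
open import Function.Bundles using (mk⇔)
open import Function.Definitions using (Injective)
open import Induction.WellFounded using (Acc; acc; WellFounded)
open import Level using (0ℓ)
open import Relation.Binary.Core using (Rel; _⇒_)
open import Relation.Binary.Definitions using (Decidable; Transitive)
open import Relation.Binary.Structures using (IsStrictPartialOrder)
open import Relation.Binary.Construct.Closure.ReflexiveTransitive as Star using (Star; ε; _◅_; _◅◅_)
open import Relation.Binary.Construct.Closure.Transitive as Plus using (TransClosure; [_]; _∷_; _++_)
open import Relation.Binary.PropositionalEquality
  using (_≡_; _≢_; refl; sym; trans; cong; subst; subst₂; isEquivalence; resp₂)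
open import Relation.Nullary using (¬_; Dec; yes; no)
open import Relation.Nullary.Decidable using (_×-dec_; _⊎-dec_; ¬?; map′; decidable-stable)

-- Closures of a relation

module _ {V : Set} {R : Rel V 0ℓ} where

  plus⇒star : TransClosure R ⇒ Star R
  plus⇒star [ r ]   = r ◅ ε
  plus⇒star (r ∷ p) = r ◅ plus⇒star p

  arc◅star⇒plus : ∀ {x y z} → R x y → Star R y z → TransClosure R x z
  arc◅star⇒plus r ε       = [ r ]
  arc◅star⇒plus r (q ◅ s) = r ∷ arc◅star⇒plus q s

  star⇒≡⊎plus : ∀ {x y} → Star R x y → x ≡ y ⊎ TransClosure R x y
  star⇒≡⊎plus ε       = inj₁ refl
  star⇒≡⊎plus (r ◅ s) = inj₂ (arc◅star⇒plus r s)

  plus-map : ∀ {S : Rel V 0ℓ} → (∀ {x y} → R x y → TransClosure S x y) → TransClosure R ⇒ TransClosure S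
  plus-map f [ r ]   = f r
  plus-map f (r ∷ p) = f r ++ plus-map f p

-- Walks as vertex sequences

module _ {V : Set} {R : Rel V 0ℓ} where

  len : ∀ {x y} → Star R x y → ℕ
  len ε       = zero
  len (r ◅ s) = suc (len s)

  vertexAt : ∀ {x y} (s : Star R x y) → Fin (suc (len s)) → V
  vertexAt {x} s       zero    = x
  vertexAt     (r ◅ s) (suc i) = vertexAt s i

  vertexAt-last : ∀ {x y} (s : Star R x y) → vertexAt s (fromℕ (len s)) ≡ y
  vertexAt-last ε       = refl
  vertexAt-last (r ◅ s) = vertexAt-last s

  vertexAt-step : ∀ {x y} (s : Star R x y) (i : Fin (len s)) → R (vertexAt s (inject₁ i)) (vertexAt s (suc i))
  vertexAt-step (r ◅ s) zero    = r
  vertexAt-step (r ◅ s) (suc i) = vertexAt-step s i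

  len-◅◅ʳ : ∀ {x y z} (s : Star R x y) (t : Star R y z) → len t ≤ len (s ◅◅ t)
  len-◅◅ʳ ε       t = ≤-refl
  len-◅◅ʳ (r ◅ s) t = m≤n⇒m≤1+n (len-◅◅ʳ s t)

  -- Existence of a position is enough, because `TransitiveDigraph` ignores the order along the
  -- path.
  ◅◅-index : ∀ {x y z} (s : Star R x y) (t : Star R y z) (i : Fin (suc (len t))) →
             ∃ λ j → vertexAt (s ◅◅ t) j ≡ vertexAt t i
  ◅◅-index ε       t i = i , refl
  ◅◅-index (r ◅ s) t i with j , eq ← ◅◅-index s t i = suc j , eq

  IsWalk : (m : ℕ) → (Fin (suc m) → V) → Set
  IsWalk m f = ∀ (i : Fin m) → R (f (inject₁ i)) (f (suc i))

  star-fromSource : ∀ {m} (f : Fin (suc m) → V) → IsWalk m f → ∀ i → Star R (f zero) (f i)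
  star-fromSource         f st zero    = ε
  star-fromSource {suc m} f st (suc i) = st zero ◅ star-fromSource (f ∘ suc) (st ∘ suc) i

  star-toTarget : ∀ {m} (f : Fin (suc m) → V) → IsWalk m f → ∀ i → Star R (f i) (f (fromℕ m))
  star-toTarget         f st zero    = star-fromSource f st (fromℕ _)
  star-toTarget {suc m} f st (suc i) = star-toTarget (f ∘ suc) (st ∘ suc) i

  -- By induction the walk without its first and the walk without its last vertex are injective; so only the
  -- two ends can coincide, and then dropping the last vertex leaves a directed cycle on distinct vertices.
  walk-injective : ¬ DirectedCycle R → ∀ {m} (f : Fin (suc m) → V) → IsWalk m f → Injective _≡_ _≡_ f
  walk-injective ac {zero}  f st {zero} {zero} _ = refl
  walk-injective ac {suc m} f st = inj
    where
    tail-inj : Injective _≡_ _≡_ (f ∘ suc)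
    tail-inj = walk-injective ac (f ∘ suc) (st ∘ suc)

    init-inj : Injective _≡_ _≡_ (f ∘ inject₁)
    init-inj = walk-injective ac (f ∘ inject₁) (st ∘ inject₁)

    zero≢suc : ∀ j → f zero ≢ f (suc j)
    zero≢suc j eq with view j
    ... | ‵fromℕ = ac (m , record { vertex = f ∘ inject₁ ; distinct = init-inj ; step = st ∘ inject₁ }
                         , subst (R _) (sym eq) (st (fromℕ m)))
    ... | ‵inject₁ k with () ← init-inj {zero} {suc k} eq

    inj : Injective _≡_ _≡_ f
    inj {zero}  {zero}  _  = refl
    inj {zero}  {suc j} eq = ⊥-elim (zero≢suc j eq)
    inj {suc i} {zero}  eq = ⊥-elim (zero≢suc i (sym eq))
    inj {suc i} {suc j} eq = cong suc (tail-inj eq)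

  -- A nonempty closed walk would have equal vertices at its first and last positions, against
  -- `walk-injective`.
  acyclic⇒plus-irrefl : ¬ DirectedCycle R → ∀ {x} → ¬ TransClosure R x x
  acyclic⇒plus-irrefl ac = λ { [ r ] → ends-distinct r ε refl ; (r ∷ p) → ends-distinct r (plus⇒star p) refl }
    where
    ends-distinct : ∀ {x y z} → R x y → Star R y z → x ≢ z
    ends-distinct r s eq
      with () ← walk-injective ac (vertexAt (r ◅ s)) (vertexAt-step (r ◅ s))
                  {zero} {fromℕ _} (trans eq (sym (vertexAt-last s)))

  plus-irrefl⇒acyclic : (∀ {x} → ¬ TransClosure R x x) → ¬ DirectedCycle R
  plus-irrefl⇒acyclic irr (m , p , r) = irr (arc◅star⇒plus r (star-fromSource (vertex p) (step p) (fromℕ m)))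

-- The chord criterion for shortcuts

ChordCriterion : {V : Set} → Rel V 0ℓ → Set
ChordCriterion R = ∀ {x y a b c} → R x y → Star R x a → R a b → R b c → Star R c y → R a c

module _ {V : Set} {R : Rel V 0ℓ} where

  -- Each vertex of the path is reachable from the source and reaches the target, so the criterion
  -- applies to arcs x → y → z among them wherever they lie on the path.
  criterion⇒¬shortcut : ChordCriterion R → ¬ Shortcut R
  criterion⇒¬shortcut ch (m , _ , p , st , ¬tr) = ¬tr λ x y z _ _ _ xy yz →
    ch st (star-fromSource (vertex p) (step p) x) xy yz (star-toTarget (vertex p) (step p) z)

  -- By acyclicity the walk x ⇝ a → b → c ⇝ y has distinct vertices. If it has at least three arcs,
  -- a missing chord a → c makes it a shortcut.
  ¬shortcut⇒criterion : Decidable R → ¬ DirectedCycle R → ¬ Shortcut R → ChordCriterion R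
  ¬shortcut⇒criterion R? ac ns {x} {y} {a} {b} {c} xy p ab bc q =
    decidable-stable (R? a c) (¬¬chord p q xy)
    where
    loop : ∀ {v w} → R v w → v ≢ w
    loop r refl = acyclic⇒plus-irrefl ac [ r ]

    two-cycle : ∀ {u v w} → R u v → R v w → u ≢ w
    two-cycle r r′ refl = acyclic⇒plus-irrefl ac (r ∷ [ r′ ])

    ¬¬long : (p : Star R x a) (q : Star R c y) → 3 ≤ len (p ◅◅ ab ◅ bc ◅ q) → R x y → ¬ ¬ R a c
    ¬¬long p q 3≤ xy ¬ac = ns (len w , s≤s 3≤ , path , subst (R x) (sym (vertexAt-last w)) xy , ¬tr)
      where
      t = ab ◅ bc ◅ q
      w = p ◅◅ t
      path : DirectedPath R (len w)
      path = record { vertex   = vertexAt w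
                    ; distinct = walk-injective ac (vertexAt w) (vertexAt-step w)
                    ; step     = vertexAt-step w }
      ¬tr : ¬ TransitiveDigraph (R on vertexAt w)
      ¬tr tr with ◅◅-index p t zero | ◅◅-index p t (suc zero) | ◅◅-index p t (suc (suc zero))
      ... | i , wi≡a | j , wj≡b | k , wk≡c = ¬ac (subst₂ R wi≡a wk≡c
              -- The positions differ because their vertices do: there are no loops and no 2-cycles.
              (tr i j k (loop ij ∘ cong (vertexAt w)) (loop jk ∘ cong (vertexAt w))
                        (two-cycle ij jk ∘ cong (vertexAt w)) ij jk))
        where
        ij = subst₂ R (sym wi≡a) (sym wj≡b) ab
        jk = subst₂ R (sym wj≡b) (sym wk≡c) bc

    ¬¬chord : Star R x a → Star R c y → R x y → ¬ ¬ R a c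
    -- Two arcs are too few for a shortcut, but here x = a and c = y, so x → y is itself the chord.
    ¬¬chord ε         ε         xy = λ ¬ac → ¬ac xy
    ¬¬chord ε         q@(_ ◅ _) xy = ¬¬long ε q (s≤s (s≤s (s≤s z≤n))) xy
    ¬¬chord p@(_ ◅ p′) q        xy = ¬¬long p q (s≤s 2≤) xy
      where
      2≤ : 2 ≤ len (p′ ◅◅ ab ◅ bc ◅ q)
      2≤ = ≤-trans (s≤s (s≤s z≤n)) (len-◅◅ʳ p′ (ab ◅ bc ◅ q))

  -- With a → b moved into the prefix, the rest b ⇝ c first shrinks to an arc; one use of the
  -- criterion then gives the chord.
  criterion⁺ : ChordCriterion R → ∀ {x y a c} → R x y → Star R x a → TransClosure R a c → Star R c y → R a c
  criterion⁺ ch xy p [ ac ]    q = ac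
  criterion⁺ ch xy p (ab ∷ bc) q = ch xy p ab (criterion⁺ ch xy (p ◅◅ ab ◅ ε) bc q) q

-- Adding one arc

addArc : {V : Set} → Rel V 0ℓ → V → V → Rel V 0ℓ
addArc R u v x y = R x y ⊎ (x ≡ u × y ≡ v)

module _ {V : Set} (R : Rel V 0ℓ) where

  -- Phrased with `addArc` because a → c is exactly the chord that the new arc u → v will require.
  Minimal : V → V → Set
  Minimal u v = ∀ {a c} → Star R u a → TransClosure R a c → Star R c v → addArc R u v a c

  Incomparable : V → V → Set
  Incomparable u v = u ≢ v × ¬ R u v × ¬ R v u

  Critical : V → V → Set
  Critical u v = (∀ {x} → R x u → R x v) × (∀ {y} → R v y → R u y)

-- Acyclic relations on Fin n

module _ {n : ℕ} {R : Rel (Fin n) 0ℓ} (R? : Decidable R) (irr : ∀ {x} → ¬ TransClosure R x x) where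

  plus-isStrictPartialOrder : IsStrictPartialOrder _≡_ (TransClosure R)
  plus-isStrictPartialOrder = record
    { isEquivalence = isEquivalence
    ; irrefl        = λ { refl → irr }
    ; trans         = _++_
    ; <-resp-≈      = resp₂ (TransClosure R)
    }

  plus-wf : WellFounded (TransClosure R)
  plus-wf = spo-wellFounded plus-isStrictPartialOrder

  plus-coWf : WellFounded (flip (TransClosure R))
  plus-coWf = spo-noetherian plus-isStrictPartialOrder

  plus? : Decidable (TransClosure R)
  plus? x y = go (plus-coWf x)
    where
    go : ∀ {x} → Acc (flip (TransClosure R)) x → Dec (TransClosure R x y)
    go {x} (acc rs) = map′ [ [_] , (λ (_ , r , p) → r ∷ p) ]′
      (λ { [ r ] → inj₁ r ; (r ∷ p) → inj₂ (_ , r , p) })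
      (R? x y ⊎-dec any? next?)
      where
      next? : ∀ w → Dec (R x w × TransClosure R w y)
      -- The arc is tested first, since only a proof of it makes the recursive call at w accessible.
      next? w with R? x w
      ... | no ¬r = no (¬r ∘ proj₁)
      ... | yes r = map′ (r ,_) proj₂ (go (rs [ r ]))

  star? : Decidable (Star R)
  star? x y = map′ [ (λ { refl → ε }) , plus⇒star ]′ star⇒≡⊎plus ((x ≟ y) ⊎-dec plus? x y)

  missingArc? : Dec (∃₂ λ u v → TransClosure R u v × ¬ R u v)
  missingArc? = any? λ u → any? λ v → plus? u v ×-dec ¬? (R? u v)

  noMissingArc⇒transitive : ¬ (∃₂ λ u v → TransClosure R u v × ¬ R u v) → Transitive R
  noMissingArc⇒transitive closed {x} {y} {z} xy yz =
    decidable-stable (R? x z) λ ¬xz → closed (x , z , xy ∷ [ yz ] , ¬xz)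

  -- Lexicographic descent: a smaller missing pair either starts strictly above u, or starts at u
  -- and ends strictly below v.
  minimal-missingArc : ∀ {u v} → TransClosure R u v → ¬ R u v →
    ∃₂ λ u v → TransClosure R u v × ¬ R u v × Minimal R u v
  minimal-missingArc {u} {v} = go (plus-coWf u) (plus-wf v)
    where
    go : ∀ {u v} → Acc (flip (TransClosure R)) u → Acc (TransClosure R) v → TransClosure R u v → ¬ R u v →
      ∃₂ λ u v → TransClosure R u v × ¬ R u v × Minimal R u v
    go {u} {v} wu wv uv ¬uv
      with any? (λ a → any? (λ c → star? u a ×-dec plus? a c ×-dec star? c v ×-dec
                 ¬? (R? a c ⊎-dec ((a ≟ u) ×-dec (c ≟ v)))))
    ... | no ¬smaller = u , v , uv , ¬uv , λ {a} {c} ua ac cv →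
            decidable-stable (R? a c ⊎-dec ((a ≟ u) ×-dec (c ≟ v)))
              (λ ¬q → ¬smaller (a , c , ua , ac , cv , ¬q))
    ... | yes (a , c , ua , ac , cv , ¬q) with wu | wv | star⇒≡⊎plus ua | star⇒≡⊎plus cv
    ...   | acc ru | _      | inj₂ ua⁺  | _         = go (ru ua⁺) (plus-wf c) ac (¬q ∘ inj₁)
    ...   | wu     | acc rv | inj₁ refl | inj₂ cv⁺  = go wu (rv cv⁺) ac (¬q ∘ inj₁)
    ...   | _      | _      | inj₁ refl | inj₁ refl = ⊥-elim (¬q (inj₂ (refl , refl)))

  -- Each failure of criticality yields a new incomparable pair, with u replaced by something below
  -- it or v by something above it.
  critical-pair : Transitive R → ∀ {u v} → Incomparable R u v → ∃₂ λ u v → Incomparable R u v × Critical R u v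
  critical-pair tr {u} {v} = go (plus-wf u) (plus-coWf v)
    where
    go : ∀ {u v} → Acc (TransClosure R) u → Acc (flip (TransClosure R)) v → Incomparable R u v →
      ∃₂ λ u v → Incomparable R u v × Critical R u v
    go {u} {v} wu wv inc@(u≢v , ¬uv , ¬vu)
      with wu | wv | any? (λ x → R? x u ×-dec ¬? (R? x v)) | any? (λ y → R? v y ×-dec ¬? (R? u y))
    ... | acc ru | _ | yes (x , xu , ¬xv) | _ =
            -- Either x = v or v → x would give v → u.
            go (ru [ xu ]) (plus-coWf v) ((λ { refl → ¬vu xu }) , ¬xv , λ vx → ¬vu (tr vx xu))
    ... | wu | acc rv | no _ | yes (y , vy , ¬uy) =
            go wu (rv [ vy ]) ((λ { refl → ¬vu vy }) , ¬uy , λ yu → ¬vu (tr vy yu))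
    ... | _ | _ | no ¬x | no ¬y = u , v , inc ,
            (λ {x} xu → decidable-stable (R? x v) λ ¬xv → ¬x (x , xu , ¬xv)) ,
            (λ {y} vy → decidable-stable (R? u y) λ ¬uy → ¬y (y , vy , ¬uy))

module _ {V : Set} {R : Rel V 0ℓ} where

  addArc-reachable : ∀ {u v} → TransClosure R u v → addArc R u v ⇒ TransClosure R
  addArc-reachable uv (inj₁ r)             = [ r ]
  addArc-reachable uv (inj₂ (refl , refl)) = uv

  -- The walk may itself use the new arc, so it is lowered to `R` first. There a → b → c can become
  -- longer, hence `criterion⁺`.
  addArc-criterion : ∀ {u v} → ChordCriterion R → TransClosure R u v → Minimal R u v →
    ChordCriterion (addArc R u v)
  addArc-criterion {u} {v} ch uv min {a = a} {c = c} xy xa ab bc cy = chord xy (lower xa) ac (lower cy)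
    where
    ac : TransClosure R a c
    ac = addArc-reachable uv ab ++ addArc-reachable uv bc

    lower : Star (addArc R u v) ⇒ Star R
    lower = Star.concat ∘ Star.map (plus⇒star ∘ addArc-reachable uv)

    chord : ∀ {x y} → addArc R u v x y → Star R x a → TransClosure R a c → Star R c y → addArc R u v a c
    chord (inj₁ r)             xa ac cy = inj₁ (criterion⁺ ch r xa ac cy)
    chord (inj₂ (refl , refl)) xa ac cy = min xa ac cy

  -- The two mixed compositions are the two halves of `Critical`; composing the new arc with itself
  -- would force u = v.
  addArc-transitive : ∀ {u v} → Transitive R → u ≢ v → Critical R u v → Transitive (addArc R u v)
  addArc-transitive tr u≢v _        (inj₁ p)             (inj₁ q)             = inj₁ (tr p q)
  addArc-transitive tr u≢v (dn , _) (inj₁ p)             (inj₂ (refl , refl)) = inj₁ (dn p)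
  addArc-transitive tr u≢v (_ , up) (inj₂ (refl , refl)) (inj₁ q)             = inj₁ (up q)
  addArc-transitive tr u≢v _        (inj₂ (_ , y≡v))     (inj₂ (y≡u , _))     = ⊥-elim (u≢v (trans (sym y≡u) y≡v))

-- Extending the orientation of a graph

module _ {n : ℕ} (G : Graph n) (φ : Orientation G) where

  arc? : Decidable (Arc φ)
  arc? x y with adj? G x y
  ... | no ¬xy = no (¬xy ∘ arc⇒adj φ)
  ... | yes xy with covers φ xy
  ...   | inj₁ r = yes r
  ...   | inj₂ r = no (arc-asym φ r)

  ¬arcs⇒¬adj : ∀ {u v} → ¬ Arc φ u v → ¬ Arc φ v u → ¬ Adj G u v
  ¬arcs⇒¬adj ¬uv ¬vu = [ ¬uv , ¬vu ]′ ∘ covers φ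

  module _ {u v : Fin n} (u≢v : u ≢ v) (¬uv : ¬ Adj G u v) where

    addArc-orientation : Orientation (addEdge G u v u≢v)
    addArc-orientation = record
      { Arc      = addArc (Arc φ) u v
      ; arc⇒adj  = λ { (inj₁ r) → inj₁ (arc⇒adj φ r) ; (inj₂ e) → inj₂ (inj₁ e) }
      ; covers   = λ { (inj₁ e) → [ inj₁ ∘ inj₁ , inj₂ ∘ inj₁ ]′ (covers φ e)
                     ; (inj₂ (inj₁ e)) → inj₁ (inj₂ e)
                     ; (inj₂ (inj₂ (x≡v , y≡u))) → inj₂ (inj₂ (y≡u , x≡v)) }
      ; arc-asym = λ { (inj₁ r) (inj₁ r′) → arc-asym φ r r′
                     ; (inj₁ r) (inj₂ (refl , refl)) → ¬uv (adj-sym G (arc⇒adj φ r))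
                     ; (inj₂ (refl , refl)) (inj₁ r) → ¬uv (adj-sym G (arc⇒adj φ r))
                     ; (inj₂ (refl , _)) (inj₂ (_ , x≡v)) → u≢v x≡v }
      }

    addArc-extends : Extends addArc-orientation φ
    addArc-extends x y xy = mk⇔ (λ { (inj₁ r) → r ; (inj₂ (refl , refl)) → ⊥-elim (¬uv xy) }) inj₁

¬complete⇒nonadjacent : ∀ {n} (G : Graph n) → ¬ Complete G → ∃₂ λ u v → u ≢ v × ¬ Adj G u v
¬complete⇒nonadjacent G ¬K with any? (λ u → any? (λ v → ¬? (u ≟ v) ×-dec ¬? (adj? G u v)))
... | yes w = w
... | no ¬w = ⊥-elim (¬K λ u v u≢v → decidable-stable (adj? G u v) λ ¬uv → ¬w (u , v , u≢v , ¬uv))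

theorem1p8 : (n : ℕ) (G : Graph n) → ¬ Complete G →
    (φ : Orientation G) → SemiTransitive φ →
    Σ (Fin n) λ u → Σ (Fin n) λ v → Σ (u ≢ v) λ u≢v →
    ¬ Adj G u v ×
    Σ (Orientation (addEdge G u v u≢v)) λ ψ → SemiTransitive ψ × Extends ψ φ
theorem1p8 n G ¬K φ (ac , ns) with missingArc? (arc? G φ) (acyclic⇒plus-irrefl ac)
... | yes (_ , _ , uv₀ , ¬uv₀)
  with u , v , uv , ¬uv , min ← minimal-missingArc (arc? G φ) (acyclic⇒plus-irrefl ac) uv₀ ¬uv₀
  = u , v , u≢v , ¬adj , addArc-orientation G φ u≢v ¬adj
  , ( plus-irrefl⇒acyclic (irr ∘ plus-map (addArc-reachable uv))
    , criterion⇒¬shortcut (addArc-criterion (¬shortcut⇒criterion (arc? G φ) ac ns) uv min) )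
  , addArc-extends G φ u≢v ¬adj
  where
  irr : ∀ {x} → ¬ TransClosure (Arc φ) x x
  irr = acyclic⇒plus-irrefl ac

  u≢v : u ≢ v
  u≢v refl = irr uv

  ¬adj : ¬ Adj G u v
  -- An arc v → u would close a cycle with u ⇝ v.
  ¬adj = ¬arcs⇒¬adj G φ ¬uv λ vu → irr (vu ∷ uv)
... | no closed
  -- Non-completeness enters here: it supplies the incomparable pair to start from.
  with _ , _ , u₀≢v₀ , ¬adj₀ ← ¬complete⇒nonadjacent G ¬K
  with u , v , (u≢v , ¬uv , ¬vu) , crit ←
         critical-pair (arc? G φ) (acyclic⇒plus-irrefl ac)
           (noMissingArc⇒transitive (arc? G φ) (acyclic⇒plus-irrefl ac) closed)
           (u₀≢v₀ , ¬adj₀ ∘ arc⇒adj φ , ¬adj₀ ∘ adj-sym G ∘ arc⇒adj φ)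
  = u , v , u≢v , ¬adj , addArc-orientation G φ u≢v ¬adj
  -- Transitivity collapses a closed walk to a loop, and gives every chord a → c directly.
  , ( plus-irrefl⇒acyclic (irr⁺ ∘ Plus.transitive⁻ _ tr⁺)
    , criterion⇒¬shortcut (λ _ _ ab bc _ → tr⁺ ab bc) )
  , addArc-extends G φ u≢v ¬adj
  where
  ¬adj : ¬ Adj G u v
  ¬adj = ¬arcs⇒¬adj G φ ¬uv ¬vu

  tr⁺ : Transitive (addArc (Arc φ) u v)
  tr⁺ = addArc-transitive (noMissingArc⇒transitive (arc? G φ) (acyclic⇒plus-irrefl ac) closed) u≢v crit

  irr⁺ : ∀ {x} → ¬ addArc (Arc φ) u v x x
  irr⁺ (inj₁ r)            = arc-asym φ r r
  irr⁺ (inj₂ (refl , x≡v)) = u≢v x≡v
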